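{- Let $k\ge2$ and let $\alpha$ be an irrational real number with a $k$-automatic continued fraction expansion $[a_0,a_1,a_2,\ldots]$. Let $p_n/q_n$ be the $n$-th convergent of $\alpha$. Let $\beta=\liminf_{n\to\infty}p_n/p_{n-1}$, $\gamma=\liminf_{n\to\infty}q_n/q_{n-1}$, $\delta=\limsup_{n\to\infty}p_n/p_{n-1}$ and $\zeta=\limsup_{n\to\infty}q_n/q_{n-1}$. Then the continued fraction expansion of each of $\beta,\gamma,\delta,\zeta$ is $k$-automatic.
   Context: A continued fraction expansion $[a_0,a_1,\ldots]$ is called $k$-automatic if its partial quotients are bounded and the sequence $(a_i)_{i\ge0}$ is $k$-automatic, i.e., there is a deterministic finite automaton with output $M=(Q,\{0,\ldots,k-1\},\Delta,\delta',q_0,\tau)$ with $a_n=\tau(\delta'(q_0,w^R))$ for every base-$k$ representation $w$ of $n$ (leading zeros allowed), $w^R$ the reversal of $w$. The convergents are $p_n/q_n=[a_0,a_1,\ldots,a_n]$ with $p_n,q_n$ given by the standard recurrences $p_n=a_np_{n-1}+p_{n-2}$, $q_n=a_nq_{n-1}+q_{n-2}$, $p_{ -1}=1,q_{ -1}=0,p_{ -2}=0,q_{ -2}=1$. -}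

module Defs where

open import Data.Nat as ℕ using (ℕ; zero; suc)
open import Data.Integer as ℤ using (ℤ; +_; +[1+_]; -[1+_]; ∣_∣)
open import Data.Fin using (Fin; toℕ)
open import Data.List using (List; foldr; foldl)
open import Data.Product using (Σ; ∃; _×_)
open import Data.Rational.Unnormalised as ℚ using (ℚᵘ; mkℚᵘ; 0ℚᵘ)
open import Relation.Binary.PropositionalEquality using (_≡_)

IsCFSeq : (ℕ → ℤ) → Set
IsCFSeq a = (i : ℕ) → ℤ._≤_ (+ 1) (a (suc i))

Bounded : (ℕ → ℤ) → Set
Bounded a = ∃ λ (B : ℕ) → (i : ℕ) → ∣ a i ∣ ℕ.≤ B

-- value of a base-k digit list, least significant digit first
-- (i.e. the list is w^R for a base-k representation w, leading zeros allowed)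
digitsVal : (k : ℕ) → List (Fin k) → ℕ
digitsVal k = foldr (λ d acc → toℕ d ℕ.+ k ℕ.* acc) 0

-- k-automatic sequence: a DFAO with finitely many states (Fin nQ),
-- input alphabet {0,…,k-1}, output map τ into ℤ, such that
-- a n = τ(δ'(q0, w^R)) for every base-k representation w of n.
Automatic : (k : ℕ) → (ℕ → ℤ) → Set
Automatic k a =
  Σ ℕ λ nQ → Σ (Fin nQ → Fin k → Fin nQ) λ δ → Σ (Fin nQ) λ q0 →
  Σ (Fin nQ → ℤ) λ τ →
    (ds : List (Fin k)) → a (digitsVal k ds) ≡ τ (foldl δ q0 ds)

AutomaticCF : (k : ℕ) → (ℕ → ℤ) → Set
AutomaticCF k a = IsCFSeq a × Bounded a × Automatic k a

-- shifted numerators/denominators: P a 0 = p_{-2}, P a 1 = p_{-1}, P a (n+2) = p_n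
P : (ℕ → ℤ) → ℕ → ℤ
P a zero = + 0
P a (suc zero) = + 1
P a (suc (suc n)) = a n ℤ.* P a (suc n) ℤ.+ P a n

Q : (ℕ → ℤ) → ℕ → ℤ
Q a zero = + 1
Q a (suc zero) = + 0
Q a (suc (suc n)) = a n ℤ.* Q a (suc n) ℤ.+ Q a n

p : (ℕ → ℤ) → ℕ → ℤ
p a n = P a (suc (suc n))

q : (ℕ → ℤ) → ℕ → ℤ
q a n = Q a (suc (suc n))

-- the rational x / y (for y ≠ 0); conventionally 0 when y = 0
frac : ℤ → ℤ → ℚᵘ
frac x (+ zero) = 0ℚᵘ
frac x +[1+ n ] = mkℚᵘ x n
frac x -[1+ n ] = mkℚᵘ (ℤ.- x) n

conv : (ℕ → ℤ) → ℕ → ℚᵘ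
conv a n = frac (p a n) (q a n)

-- Comparisons between a rational r and the real number x = lim conv b m
-- (the value of the infinite continued fraction [b_0, b_1, ...]).
_<CF_ : ℚᵘ → (ℕ → ℤ) → Set
r <CF b = ∃ λ (ε : ℚᵘ) → ℚ._<_ 0ℚᵘ ε × ∃ λ (M : ℕ) →
            (m : ℕ) → M ℕ.≤ m → ℚ._≤_ (r ℚ.+ ε) (conv b m)

_CF<_ : (ℕ → ℤ) → ℚᵘ → Set
b CF< r = ∃ λ (ε : ℚᵘ) → ℚ._<_ 0ℚᵘ ε × ∃ λ (M : ℕ) →
            (m : ℕ) → M ℕ.≤ m → ℚ._≤_ (conv b m ℚ.+ ε) r

IsLiminf : (ℕ → ℚᵘ) → (ℕ → ℤ) → Set
IsLiminf s b =
  ((r : ℚᵘ) → r <CF b → ∃ λ (N : ℕ) → (n : ℕ) → N ℕ.≤ n → ℚ._<_ r (s n)) ×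
  ((r : ℚᵘ) → b CF< r → (N : ℕ) → ∃ λ (n : ℕ) → N ℕ.≤ n × ℚ._<_ (s n) r)

IsLimsup : (ℕ → ℚᵘ) → (ℕ → ℤ) → Set
IsLimsup s b =
  ((r : ℚᵘ) → b CF< r → ∃ λ (N : ℕ) → (n : ℕ) → N ℕ.≤ n → ℚ._<_ (s n) r) ×
  ((r : ℚᵘ) → r <CF b → (N : ℕ) → ∃ λ (n : ℕ) → N ℕ.≤ n × ℚ._<_ r (s n))

-- ratio sequences p_{n+1}/p_n and q_{n+1}/q_n (index shift irrelevant for lim inf/sup)
pRatio : (ℕ → ℤ) → ℕ → ℚᵘ
pRatio a n = frac (p a (suc n)) (p a n)

qRatio : (ℕ → ℤ) → ℕ → ℚᵘ
qRatio a n = frac (q a (suc n)) (q a n)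

{-# OPTIONS --safe #-}

-- The ratios pₙ/pₙ₋₁ and qₙ/qₙ₋₁ expand, up to a tail, as [aₙ, aₙ₋₁, …], and continued fractions
-- are ordered by the alternating lexicographic order of their partial quotients.  Hence the
-- lim inf (lim sup) is the word b all of whose prefixes occur reversed infinitely often in a and
-- which is extremal for that order.  "b m > c" is a first-order statement over ⟨ℕ, +, a⟩, and
-- predicates recognised by finite automata are closed under the first-order connectives
-- (Büchi–Bruyère), so b is k-automatic.  The lim inf and lim sup properties need no convergence
-- estimate: a ratio whose window starts with the first l letters of b lies on the known side of
-- the convergent built from these l letters, and the side is chosen by the parity of l.
module Submission where

open import Defs
open import Data.Empty using (⊥; ⊥-elim)
open import Data.Fin as Fin using (Fin; zero; suc; toℕ; combine; remQuot)
open import Data.Fin.Patterns using (0F; 1F; 2F; 3F)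
import Data.Fin.Properties as Fin
open import Data.Fin.Subset using (Subset; _∈_) renaming (∣_∣ to ∣_∣ₛ)
open import Data.Fin.Subset.Properties using (_∈?_; ∣p∣≤n; p⊂q⇒∣p∣<∣q∣)
open import Data.Integer as ℤ using (ℤ; +_; +[1+_]; -[1+_])
import Data.Integer.Properties as ℤ
import Data.Integer.Tactic.RingSolver as ℤ-Solver
open import Data.List using (List; []; _∷_; _++_; foldl)
open import Data.List.Properties using (foldl-++)
open import Data.Nat using (ℕ; zero; suc; _+_; _*_; _∸_; _≤_; _<_; _⊔_; _⊓_; z≤n; s≤s)
open import Data.Nat.DivMod using (_divMod_; result)
open import Data.Nat.Induction using (<-rec)
open import Data.Nat.Properties
open import Data.Nat.Tactic.RingSolver using (solve-∀)
open import Data.Product using (Σ; ∃; _×_; _,_; proj₁; proj₂)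
open import Data.Rational.Unnormalised as ℚ using (ℚᵘ; 0ℚᵘ; *≤*)
import Data.Rational.Unnormalised.Properties as ℚ
open import Data.Sum as Sum using (_⊎_; inj₁; inj₂)
open import Data.Unit using (⊤; tt)
open import Data.Vec using (Vec; []; _∷_; lookup; zipWith; replicate; tabulate)
open import Data.Vec.Properties
  using (lookup-zipWith; lookup-replicate; lookup∘tabulate; zipWith-replicate; []=⇒lookup; lookup⇒[]=)
open import Data.Vec.Relation.Unary.All as All using (All; []; _∷_)
open import Function using (_∘_; id)
open import Relation.Binary.Definitions using (tri<; tri≈; tri>)
open import Relation.Binary.PropositionalEquality
open import Relation.Nullary using (¬_; Dec; yes; no; does)
open import Relation.Nullary.Decidable
  using (_×-dec_; _⊎-dec_; ¬?; map′; decidable-stable; dec-true)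

infix 3 _⟺_
_⟺_ : Set → Set → Set
A ⟺ B = (A → B) × (B → A)

-- Decidable subsets of a finite set and reachability in a finite graph.

module _ {N : ℕ} {Q : Fin N → Set} (Q? : ∀ i → Dec (Q i)) where

  comprehension : Subset N
  comprehension = tabulate (does ∘ Q?)

  ∈-comprehension⁺ : ∀ {i} → Q i → i ∈ comprehension
  ∈-comprehension⁺ {i} q =
    lookup⇒[]= i _ (trans (lookup∘tabulate (does ∘ Q?) i) (dec-true (Q? i) q))

  ∈-comprehension⁻ : ∀ {i} → i ∈ comprehension → Q i
  ∈-comprehension⁻ {i} m with Q? i | trans (sym (lookup∘tabulate (does ∘ Q?) i)) ([]=⇒lookup m)
  ... | yes q | _ = q

module Reachability {N m : ℕ} (step : Fin N → Fin m → Fin N)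
                    {G : Fin N → Set} (G? : ∀ i → Dec (G i)) where

  Within : ℕ → Fin N → Set
  Within zero    i = G i
  Within (suc j) i = Within j i ⊎ ∃ λ d → Within j (step i d)

  Within? : ∀ j i → Dec (Within j i)
  Within? zero    i = G? i
  Within? (suc j) i = Within? j i ⊎-dec Fin.any? λ d → Within? j (step i d)

  Stable : ℕ → Set
  Stable j = ∀ i → Within (suc j) i → Within j i

  -- Each stage that is not stable contributes a new state, so without a stable stage the sets
  -- `Within j` would grow beyond all N states.
  stable-or-large : ∀ j → ∃ Stable ⊎ (j ≤ ∣ comprehension (Within? j) ∣ₛ)
  stable-or-large zero = inj₂ z≤n
  stable-or-large (suc j) with stable-or-large j
  ... | inj₁ st = inj₁ st
  ... | inj₂ j≤ with Fin.any? (λ i → Within? (suc j) i ×-dec ¬? (Within? j i))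
  ...   | yes (i , new , ¬old) = inj₂ (≤-trans (s≤s j≤) (p⊂q⇒∣p∣<∣q∣
            ( (∈-comprehension⁺ (Within? (suc j)) ∘ inj₁ ∘ ∈-comprehension⁻ (Within? j))
            , i , ∈-comprehension⁺ (Within? (suc j)) new
            , (¬old ∘ ∈-comprehension⁻ (Within? j)))))
  ...   | no none = inj₁ (j , λ i new →
            decidable-stable (Within? j i) λ ¬old → none (i , new , ¬old))

  stable : ∃ Stable
  stable with stable-or-large (suc N)
  ... | inj₁ st = st
  ... | inj₂ N< = ⊥-elim (<-irrefl refl (≤-trans N< (∣p∣≤n (comprehension (Within? (suc N))))))

  within-stable : ∀ j → Stable j → ∀ m {i} → Within m i → Within j i
  within-stable j st zero g = base j
    where
    base : ∀ j → Within j _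
    base zero    = g
    base (suc j) = inj₁ (base j)
  within-stable j st (suc m) (inj₁ w)       = within-stable j st m w
  within-stable j st (suc m) (inj₂ (d , w)) = st _ (inj₂ (d , within-stable j st m w))

  reachable? : ∀ i → Dec (∃ λ j → Within j i)
  reachable? i with stable
  ... | j , st = map′ (j ,_) (λ (m , w) → within-stable j st m w) (Within? j i)

-- Finite state sets.

record Finite (S : Set) : Set where
  field
    size       : ℕ
    index      : S → Fin size
    enum       : Fin size → S
    enum-index : ∀ s → enum (index s) ≡ s

open Finite

Fin-finite : ∀ n → Finite (Fin n)
Fin-finite n = record { size = n ; index = id ; enum = id ; enum-index = λ _ → refl }

×-finite : ∀ {S S′} → Finite S → Finite S′ → Finite (S × S′)
×-finite A B = record
  { size       = size A * size B
  ; index      = λ (s , t) → combine (index A s) (index B t)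
  ; enum       = λ i → let (j , l) = remQuot (size B) i in enum A j , enum B l
  ; enum-index = λ (s , t) → trans
      (cong (λ (j , l) → enum A j , enum B l) (Fin.remQuot-combine (index A s) (index B t)))
      (cong₂ _,_ (enum-index A s) (enum-index B t))
  }

Subset-finite : ∀ n → Finite (Subset n)
Subset-finite zero = record
  { size = 1 ; index = λ _ → zero ; enum = λ _ → [] ; enum-index = λ { [] → refl } }
Subset-finite (suc n) = record
  { size       = size rest
  ; index      = λ { (b ∷ p) → index rest (toFin b , p) }
  ; enum       = λ i → let (b , p) = enum rest i in fromFin b ∷ p
  ; enum-index = λ { (b ∷ p) → trans
      (cong (λ (b , p) → fromFin b ∷ p) (enum-index rest (toFin b , p)))
      (cong (_∷ p) (from-to b)) }
  }
  where
  open import Data.Bool using (Bool; true; false)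
  rest = ×-finite (Fin-finite 2) (Subset-finite n)
  toFin : Bool → Fin 2
  toFin false = zero
  toFin true  = suc zero
  fromFin : Fin 2 → Bool
  fromFin zero    = false
  fromFin (suc _) = true
  from-to : ∀ b → fromFin (toFin b) ≡ b
  from-to false = refl
  from-to true  = refl

-- Base-k digits and automata reading tuples of numbers.

module Büchi (k₀ : ℕ) where

  k : ℕ
  k = suc (suc k₀)

  infixr 7 _⊕_ _⊞_

  _⊕_ : Fin k → ℕ → ℕ
  d ⊕ x = toℕ d + k * x

  _⊞_ : ∀ {n} → Vec (Fin k) n → Vec ℕ n → Vec ℕ n
  _⊞_ = zipWith _⊕_

  0s : ∀ {n} → Vec ℕ n
  0s = replicate _ 0

  0d : ∀ {n} → Vec (Fin k) n
  0d = replicate _ zero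

  0⊕0 : Fin.zero ⊕ 0 ≡ 0
  0⊕0 = *-zeroʳ k

  0d⊞0s : ∀ {n} → 0d ⊞ 0s ≡ 0s {n}
  0d⊞0s = trans (zipWith-replicate _⊕_ zero 0) (cong (replicate _) 0⊕0)

  split : ∀ x → ∃ λ d → ∃ λ y → x ≡ d ⊕ y
  split x with x divMod k
  ... | result y d eq = d , y , trans eq (cong (λ t → toℕ d + t) (*-comm y k))

  -- Since k is at least 2, dividing by k strictly decreases a positive number. This lets a bound on
  -- the number serve as fuel for recursion over its digits.
  ⊕-< : ∀ d y {m} → d ⊕ y ≤ suc m → y ≤ m
  ⊕-< d zero    _ = z≤n
  ⊕-< d (suc y) le = ≤-pred (≤-trans (≤-trans
    (≤-trans (s≤s (m≤m+n (suc y) (y + k₀ * suc y)))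
      (≤-reflexive (solve-lemma y k₀)))
    (m≤n+m _ (toℕ d))) le)
    where
    solve-lemma : ∀ y k₀ → suc (suc y + (y + k₀ * suc y)) ≡ suc (suc k₀) * suc y
    solve-lemma = solve-∀

  splits : ∀ {n} (x : Vec ℕ n) → ∃ λ d → ∃ λ y → x ≡ d ⊞ y
  splits []      = [] , [] , refl
  splits (x ∷ v) with split x | splits v
  ... | d , y , eq | ds , w , eqs = d ∷ ds , y ∷ w , cong₂ _∷_ eq eqs

  ⊞-< : ∀ {n} (d : Vec (Fin k) n) y {m} → All (_≤ suc m) (d ⊞ y) → All (_≤ m) y
  ⊞-< []       []      []         = []
  ⊞-< (d ∷ ds) (y ∷ w) (le ∷ les) = ⊕-< d y le ∷ ⊞-< ds w les

  -- Least significant digits are read first.  F s is the residual of P at the state s; the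
  -- invariant is needed because the residuals of an unreachable state of a DFAO may depend on
  -- trailing zeros.
  record Aut {n : ℕ} (P : Vec ℕ n → Set) : Set₁ where
    field
      {State} : Set
      finite  : Finite State
      δ       : State → Vec (Fin k) n → State
      start   : State
      Inv     : State → Set
      F       : State → Vec ℕ n → Set
      Acc     : State → Set
      Acc?    : ∀ s → Dec (Acc s)
      inv₀    : Inv start
      invδ    : ∀ {s} → Inv s → ∀ d → Inv (δ s d)
      spec    : ∀ x → P x ⟺ F start x
      step    : ∀ {s} → Inv s → ∀ d x → F s (d ⊞ x) ⟺ F (δ s d) x
      stop    : ∀ {s} → Inv s → F s 0s ⟺ Acc s

  open Aut

  bounded : ∀ {n} (x : Vec ℕ n) → ∃ λ m → All (_≤ m) x
  bounded []      = 0 , []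
  bounded (x ∷ v) with bounded v
  ... | m , les = x ⊔ m , m≤m⊔n x m ∷ All.map (λ le → ≤-trans le (m≤n⊔m x m)) les

  -- Each digit read lowers the bound on the entries; once it is zero, only zeros remain and `stop`
  -- reduces the question to acceptance. Every predicate with an automaton is thus decidable,
  -- unbounded quantifiers included.
  decide : ∀ {n} {P : Vec ℕ n → Set} → Aut P → ∀ x → Dec (P x)
  decide {P = P} M x = map′ (proj₂ (spec M x)) (proj₁ (spec M x))
                   (go (proj₁ (bounded x)) (inv₀ M) x (proj₂ (bounded x)))
    where
    zeros : ∀ {n} (x : Vec ℕ n) → All (_≤ 0) x → x ≡ 0s
    zeros []      []         = refl
    zeros (x ∷ v) (z≤n ∷ les) = cong (0 ∷_) (zeros v les)
    go : ∀ m {s} → Inv M s → ∀ x → All (_≤ m) x → Dec (F M s x)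
    go zero {s} i x les rewrite zeros x les = map′ (proj₂ (stop M i)) (proj₁ (stop M i)) (Acc? M s)
    go (suc m) {s} i x les with splits x
    ... | d , y , refl = map′ (proj₂ (step M i d y)) (proj₁ (step M i d y))
                              (go m (invδ M i d) y (⊞-< d y les))

  transport : ∀ {n} {P P′ : Vec ℕ n → Set} → (∀ x → P x ⟺ P′ x) → Aut P → Aut P′
  transport eqv M = record
    { finite = finite M ; δ = δ M ; start = start M ; Inv = Inv M ; F = F M
    ; Acc = Acc M ; Acc? = Acc? M ; inv₀ = inv₀ M ; invδ = invδ M
    ; spec = λ x → (proj₁ (spec M x) ∘ proj₂ (eqv x)) , (proj₁ (eqv x) ∘ proj₂ (spec M x))
    ; step = step M ; stop = stop M }

  -- Closure under the first-order connectives.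

  not′ : ∀ {n} {P : Vec ℕ n → Set} → Aut P → Aut (λ x → ¬ P x)
  not′ M = record
    { finite = finite M ; δ = δ M ; start = start M ; Inv = Inv M ; F = λ s x → ¬ F M s x
    ; Acc = λ s → ¬ Acc M s ; Acc? = λ s → ¬? (Acc? M s) ; inv₀ = inv₀ M ; invδ = invδ M
    ; spec = λ x → neg (spec M x) ; step = λ i d x → neg (step M i d x) ; stop = λ i → neg (stop M i) }
    where
    neg : ∀ {A B : Set} → A ⟺ B → (¬ A) ⟺ (¬ B)
    neg (f , g) = (_∘ g) , (_∘ f)

  infixr 6 _and_
  _and_ : ∀ {n} {P P′ : Vec ℕ n → Set} → Aut P → Aut P′ → Aut (λ x → P x × P′ x)
  M and M′ = record
    { finite = ×-finite (finite M) (finite M′)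
    ; δ = λ (s , s′) d → δ M s d , δ M′ s′ d
    ; start = start M , start M′
    ; Inv = λ (s , s′) → Inv M s × Inv M′ s′
    ; F = λ (s , s′) x → F M s x × F M′ s′ x
    ; Acc = λ (s , s′) → Acc M s × Acc M′ s′
    ; Acc? = λ (s , s′) → Acc? M s ×-dec Acc? M′ s′
    ; inv₀ = inv₀ M , inv₀ M′
    ; invδ = λ (i , i′) d → invδ M i d , invδ M′ i′ d
    ; spec = λ x → both (spec M x) (spec M′ x)
    ; step = λ (i , i′) d x → both (step M i d x) (step M′ i′ d x)
    ; stop = λ (i , i′) → both (stop M i) (stop M′ i′) }
    where
    both : ∀ {A B A′ B′ : Set} → A ⟺ B → A′ ⟺ B′ → (A × A′) ⟺ (B × B′)
    both (f , g) (f′ , g′) = (λ (a , a′) → f a , f′ a′) , (λ (b , b′) → g b , g′ b′)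

  -- Subset construction.  After the other variables have become zero the quantified one may
  -- still have non-zero digits left, so acceptance of a state is reachability along zeros.
  ex : ∀ {n} {P : Vec ℕ (suc n) → Set} → Aut P → Aut (λ x → ∃ λ y → P (y ∷ x))
  ex {n} {P} M = record
    { State = Subset (size fin)
    ; finite = Subset-finite (size fin)
    ; δ = λ t d → comprehension (next? t d)
    ; start = comprehension start?
    ; Inv = λ t → ∀ {i} → i ∈ t → Inv M (enum fin i)
    ; F = λ t x → ∃ λ i → i ∈ t × ∃ λ y → F M (enum fin i) (y ∷ x)
    ; Acc = λ t → ∃ λ i → i ∈ t × ∃ λ j → R.Within j i
    ; Acc? = λ t → Fin.any? λ i → (i ∈? t) ×-dec R.reachable? i
    ; inv₀ = λ m → subst (Inv M) (sym (at-start (∈-comprehension⁻ start? m))) (inv₀ M)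
    ; invδ = λ {t} inv d m → next-inv t inv d (∈-comprehension⁻ (next? t d) m)
    ; spec = λ x →
        (λ (y , p) → index fin (start M) , ∈-comprehension⁺ start? refl , y ,
           subst (λ s → F M s (y ∷ x)) (sym (enum-index fin _)) (proj₁ (spec M _) p))
      , (λ (i , m , y , f) → y , proj₂ (spec M _)
           (subst (λ s → F M s (y ∷ x)) (at-start (∈-comprehension⁻ start? m)) f))
    ; step = λ {t} inv d x → step→ t inv d x , step← t inv d x
    ; stop = λ {t} inv →
        (λ (i , m , y , f) → i , m , zeros→ y (inv m) ≤-refl f)
      , (λ (i , m , j , w) → i , m , zeros← j (inv m) w)
    }
    where
    fin = finite M
    start? : ∀ i → Dec (i ≡ index fin (start M))
    start? = Fin._≟ index fin (start M)

    at-start : ∀ {i} → i ≡ index fin (start M) → enum fin i ≡ start M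
    at-start refl = enum-index fin _

    Next : Subset (size fin) → Vec (Fin k) n → Fin (size fin) → Set
    Next t d j = ∃ λ i → i ∈ t × ∃ λ e → index fin (δ M (enum fin i) (e ∷ d)) ≡ j

    next? : ∀ t d j → Dec (Next t d j)
    next? t d j = Fin.any? λ i → (i ∈? t) ×-dec Fin.any? λ e → _ Fin.≟ j

    next-inv : ∀ t → (∀ {i} → i ∈ t → Inv M (enum fin i)) → ∀ d {j} → Next t d j → Inv M (enum fin j)
    next-inv t inv d (i , m , e , refl) =
      subst (Inv M) (sym (enum-index fin _)) (invδ M (inv m) (e ∷ d))

    step→ : ∀ t (inv : ∀ {i} → i ∈ t → Inv M (enum fin i)) d x →
            (∃ λ i → i ∈ t × ∃ λ y → F M (enum fin i) (y ∷ (d ⊞ x))) →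
            (∃ λ i → i ∈ comprehension (next? t d) × ∃ λ y → F M (enum fin i) (y ∷ x))
    step→ t inv d x (i , m , y , f) with split y
    ... | e , z , refl = _ , ∈-comprehension⁺ (next? t d) (i , m , e , refl) , z ,
      subst (λ s → F M s (z ∷ x)) (sym (enum-index fin _)) (proj₁ (step M (inv m) (e ∷ d) (z ∷ x)) f)

    step← : ∀ t (inv : ∀ {i} → i ∈ t → Inv M (enum fin i)) d x →
            (∃ λ i → i ∈ comprehension (next? t d) × ∃ λ y → F M (enum fin i) (y ∷ x)) →
            (∃ λ i → i ∈ t × ∃ λ y → F M (enum fin i) (y ∷ (d ⊞ x)))
    step← t inv d x (j , m′ , y , f) with ∈-comprehension⁻ (next? t d) m′
    ... | i , m , e , refl = i , m , e ⊕ y ,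
      proj₂ (step M (inv m) (e ∷ d) (y ∷ x)) (subst (λ s → F M s (y ∷ x)) (enum-index fin _) f)

    zstep : Fin (size fin) → Fin k → Fin (size fin)
    zstep i e = index fin (δ M (enum fin i) (e ∷ 0d))
    module R = Reachability zstep {λ i → Acc M (enum fin i)} (λ i → Acc? M (enum fin i))

    zinv : ∀ {i} → Inv M (enum fin i) → ∀ e → Inv M (enum fin (zstep i e))
    zinv inv e = subst (Inv M) (sym (enum-index fin _)) (invδ M inv (e ∷ 0d))

    zstep-F : ∀ {i} → Inv M (enum fin i) → ∀ e y →
              F M (enum fin i) ((e ⊕ y) ∷ 0s) ⟺ F M (enum fin (zstep i e)) (y ∷ 0s)
    zstep-F {i} inv e y =
        (λ f → subst (λ s → F M s _) (sym (enum-index fin _))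
          (proj₁ (step M inv (e ∷ 0d) (y ∷ 0s)) (subst (λ v → F M (enum fin i) (e ⊕ y ∷ v)) (sym 0d⊞0s) f)))
      , (λ f → subst (λ v → F M (enum fin i) (e ⊕ y ∷ v)) 0d⊞0s
          (proj₂ (step M inv (e ∷ 0d) (y ∷ 0s)) (subst (λ s → F M s _) (enum-index fin _) f)))

    zeros→ : ∀ m {i} → Inv M (enum fin i) → ∀ {y} → y ≤ m → F M (enum fin i) (y ∷ 0s) →
             ∃ λ j → R.Within j i
    zeros→ zero    inv z≤n f = 0 , proj₁ (stop M inv) f
    zeros→ (suc m) inv {y} le f with split y
    ... | e , z , refl with zeros→ m (zinv inv e) (⊕-< e z le) (proj₁ (zstep-F inv e z) f)
    ...   | j , w = suc j , inj₂ (e , w)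

    zeros← : ∀ j {i} → Inv M (enum fin i) → R.Within j i → ∃ λ y → F M (enum fin i) (y ∷ 0s)
    zeros← zero    inv w = 0 , proj₂ (stop M inv) w
    zeros← (suc j) inv (inj₁ w) = zeros← j inv w
    zeros← (suc j) inv (inj₂ (e , w)) with zeros← j (zinv inv e) w
    ... | y , f = e ⊕ y , proj₂ (zstep-F inv e y) f

  infixr 5 _or_
  -- De Morgan's law, constructively valid here because `decide` makes both predicates stable under
  -- double negation. The same holds for `_imp_` and `all`.
  _or_ : ∀ {n} {P P′ : Vec ℕ n → Set} → Aut P → Aut P′ → Aut (λ x → P x ⊎ P′ x)
  M or M′ = transport
    (λ x → (λ h → decidable-stable (decide M x ⊎-dec decide M′ x)
                    λ ¬p → h ((¬p ∘ inj₁) , (¬p ∘ inj₂)))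
         , (λ { (inj₁ p) (¬p , _) → ¬p p ; (inj₂ p) (_ , ¬p) → ¬p p }))
    (not′ (not′ M and not′ M′))

  infixr 4 _imp_
  _imp_ : ∀ {n} {P P′ : Vec ℕ n → Set} → Aut P → Aut P′ → Aut (λ x → P x → P′ x)
  M imp M′ = transport
    (λ x → (λ h p → decidable-stable (decide M′ x) λ ¬p′ → h (p , ¬p′))
         , (λ f (p , ¬p′) → ¬p′ (f p)))
    (not′ (M and not′ M′))

  all : ∀ {n} {P : Vec ℕ (suc n) → Set} → Aut P → Aut (λ x → ∀ y → P (y ∷ x))
  all M = transport
    (λ x → (λ h y → decidable-stable (decide M (y ∷ x)) λ ¬p → h (y , ¬p))
         , (λ f (y , ¬p) → ¬p (f y)))
    (not′ (ex (not′ M)))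

  -- Atomic predicates: addition and order.

  sum : ∀ {n} (i j l : Fin n) → Aut (λ x → lookup x i + lookup x j ≡ lookup x l)
  sum {n} i j l = record
    { State = Fin 3
    ; finite = Fin-finite 3
    ; δ = λ s d → next s (toℕ (lookup d i)) (toℕ (lookup d j)) (toℕ (lookup d l))
    ; start = zero
    ; Inv = λ _ → ⊤
    ; F = λ s x → Carry s (lookup x i) (lookup x j) (lookup x l)
    ; Acc = λ s → Carry s 0 0 0
    ; Acc? = acc?
    ; inv₀ = tt
    ; invδ = λ _ _ → tt
    ; spec = λ x → id , id
    ; step = λ {s} _ d x → subst₂ _⟺_ (sym (look s d x)) refl
               (step′ s (lookup d i) (lookup d j) (lookup d l) (lookup x i) (lookup x j) (lookup x l))
    ; stop = λ {s} _ → subst (λ A → A ⟺ Carry s 0 0 0) (sym (look0 s)) (id , id)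
    }
    where
    -- The states are carry 0, carry 1 and failure.
    Carry : Fin 3 → ℕ → ℕ → ℕ → Set
    Carry zero             x y z = x + y ≡ z
    Carry (suc zero)       x y z = suc (x + y) ≡ z
    Carry (suc (suc zero)) x y z = ⊥

    acc? : ∀ s → Dec (Carry s 0 0 0)
    acc? zero             = yes refl
    acc? (suc zero)       = no λ ()
    acc? (suc (suc zero)) = no λ ()

    carry : ℕ → ℕ → Fin 3
    carry t z with t ≟ z | t ≟ z + k
    ... | yes _ | _     = zero
    ... | no _  | yes _ = suc zero
    ... | no _  | no _  = suc (suc zero)

    next : Fin 3 → ℕ → ℕ → ℕ → Fin 3
    next zero             x y z = carry (x + y) z
    next (suc zero)       x y z = carry (suc (x + y)) z
    next (suc (suc zero)) x y z = suc (suc zero)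

    -- The equation makes t - z a multiple of k, and t < 2k together with 0 ≤ z < k leaves only 0
    -- and k, which are the two possible carries.
    carry-spec : ∀ t (z : Fin k) → t < k + k → ∀ x y w →
                 (t + k * (x + y) ≡ z ⊕ w) ⟺ Carry (carry t (toℕ z)) x y w
    carry-spec t z t< x y w with t ≟ toℕ z | t ≟ toℕ z + k
    ... | yes refl | _ = (λ eq → *-cancelˡ-≡ _ _ k (+-cancelˡ-≡ (toℕ z) _ _ eq))
                       , (λ { refl → refl })
    ... | no _ | yes refl =
        (λ eq → *-cancelˡ-≡ _ _ k (+-cancelˡ-≡ (toℕ z) _ _
                  (trans (lemma (toℕ z) k (x + y)) eq)))
      , (λ { refl → sym (lemma (toℕ z) k (x + y)) })
      where
      lemma : ∀ z k s → z + k * suc s ≡ z + k + k * s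
      lemma = solve-∀
    ... | no t≢z | no t≢z+k = (λ eq → impossible eq) , λ ()
      where
      impossible : t + k * (x + y) ≡ z ⊕ w → ⊥
      impossible eq with ≤-total (x + y) w
      ... | inj₁ le with w ∸ (x + y) | m+[n∸m]≡n le
      ...   | 0 | refl = t≢z (+-cancelʳ-≡ _ _ _ (trans eq (cong (λ s → toℕ z + k * s) (+-identityʳ (x + y)))))
      ...   | 1 | refl = t≢z+k (+-cancelʳ-≡ _ _ _ (trans eq (lemma (toℕ z) k (x + y))))
        where
        lemma : ∀ z k s → z + k * (s + 1) ≡ z + k + k * s
        lemma = solve-∀
      ...   | suc (suc e) | refl = <⇒≱ t< (≤-trans (m≤n+m (k + k) (toℕ z + k * e))
                (≤-reflexive (sym (+-cancelʳ-≡ (k * (x + y)) _ _ (trans eq (lemma (toℕ z) k (x + y) e))))))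
        where
        lemma : ∀ z k s e → z + k * (s + suc (suc e)) ≡ z + k * e + (k + k) + k * s
        lemma = solve-∀
      impossible eq | inj₂ le with x + y ∸ w | m+[n∸m]≡n le
      ... | 0 | eq′ = t≢z (+-cancelʳ-≡ (k * w) _ _
              (trans (cong (λ s → t + k * s) (trans (sym (+-identityʳ w)) eq′)) eq))
      ... | suc e | eq′ = <⇒≱ (Fin.toℕ<n z) (≤-trans (m≤n+m k (t + k * e))
              (≤-reflexive (+-cancelʳ-≡ (k * w) _ _
                (trans (lemma t k w e) (trans (cong (λ s → t + k * s) eq′) eq)))))
        where
        lemma : ∀ t k w e → t + k * e + k + k * w ≡ t + k * (w + suc e)
        lemma = solve-∀

    step′ : ∀ s (a b c : Fin k) x y z →
            Carry s (a ⊕ x) (b ⊕ y) (c ⊕ z) ⟺ Carry (next s (toℕ a) (toℕ b) (toℕ c)) x y z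
    step′ zero a b c x y z = subst (λ u → (u ≡ c ⊕ z) ⟺ Carry (next zero (toℕ a) (toℕ b) (toℕ c)) x y z)
      (lemma (toℕ a) (toℕ b) k x y)
      (carry-spec (toℕ a + toℕ b) c (+-mono-< (Fin.toℕ<n a) (Fin.toℕ<n b)) x y z)
      where
      lemma : ∀ a b k x y → a + b + k * (x + y) ≡ a + k * x + (b + k * y)
      lemma = solve-∀
    step′ (suc zero) a b c x y z = subst (λ u → (u ≡ c ⊕ z) ⟺ Carry (next (suc zero) (toℕ a) (toℕ b) (toℕ c)) x y z)
      (lemma (toℕ a) (toℕ b) k x y)
      (carry-spec (suc (toℕ a + toℕ b)) c
        (≤-trans (≤-reflexive (cong suc (sym (+-suc (toℕ a) (toℕ b))))) (+-mono-≤ (Fin.toℕ<n a) (Fin.toℕ<n b))) x y z)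
      where
      lemma : ∀ a b k x y → suc (a + b) + k * (x + y) ≡ suc (a + k * x + (b + k * y))
      lemma = solve-∀
    step′ (suc (suc zero)) a b c x y z = id , id

    look : ∀ s d x → Carry s (lookup (d ⊞ x) i) (lookup (d ⊞ x) j) (lookup (d ⊞ x) l) ≡
                     Carry s (lookup d i ⊕ lookup x i) (lookup d j ⊕ lookup x j) (lookup d l ⊕ lookup x l)
    look s d x rewrite lookup-zipWith _⊕_ i d x | lookup-zipWith _⊕_ j d x | lookup-zipWith _⊕_ l d x = refl

    look0 : ∀ s → Carry s (lookup (0s {n}) i) (lookup (0s {n}) j) (lookup (0s {n}) l) ≡ Carry s 0 0 0
    look0 s rewrite lookup-replicate i 0 | lookup-replicate j 0 | lookup-replicate l 0 = refl

  lt : ∀ {n} (i j : Fin n) → Aut (λ x → lookup x i < lookup x j)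
  lt i j = transport
    (λ x → (λ h → ≰⇒> λ le → h (_ , m+[n∸m]≡n le))
         , (λ { lt (d , eq) → <⇒≱ lt (≤-trans (m≤m+n (lookup x j) d) (≤-reflexive eq)) }))
    (not′ (ex (sum (suc j) zero (suc i))))

  -- Automatic functions and their relation to recognisable predicates.

  digits : ∀ x → ∃ λ ds → digitsVal k ds ≡ x
  digits x = go x x ≤-refl
    where
    go : ∀ m x → x ≤ m → ∃ λ ds → digitsVal k ds ≡ x
    go zero    _ z≤n = [] , refl
    go (suc m) x le with split x
    ... | d , y , refl with go m y (⊕-< d y le)
    ...   | ds , refl = d ∷ ds , refl

  digitsVal-++ : ∀ ds {es es′} → digitsVal k es ≡ digitsVal k es′ →
                 digitsVal k (ds ++ es) ≡ digitsVal k (ds ++ es′)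
  digitsVal-++ []       eq = eq
  digitsVal-++ (d ∷ ds) eq = cong (d ⊕_) (digitsVal-++ ds eq)

  AutomaticFun : (ℕ → ℕ) → Set
  AutomaticFun f = Σ ℕ λ nQ → Σ (Fin nQ → Fin k → Fin nQ) λ δ → Σ (Fin nQ) λ q₀ →
    Σ (Fin nQ → ℕ) λ τ → (ds : List (Fin k)) → f (digitsVal k ds) ≡ τ (foldl δ q₀ ds)

  module _ {f : ℕ → ℕ} (M : AutomaticFun f) where

    private
      nQ : ℕ
      nQ = proj₁ M

      Δ : Fin nQ → Fin k → Fin nQ
      Δ = proj₁ (proj₂ M)

      q₀ : Fin nQ
      q₀ = proj₁ (proj₂ (proj₂ M))

      τ : Fin nQ → ℕ
      τ = proj₁ (proj₂ (proj₂ (proj₂ M)))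

      f-aut : ∀ ds → f (digitsVal k ds) ≡ τ (foldl Δ q₀ ds)
      f-aut = proj₂ (proj₂ (proj₂ (proj₂ M)))

      digs : ℕ → List (Fin k)
      digs = proj₁ ∘ digits

      val : Fin nQ → ℕ → ℕ
      val q x = τ (foldl Δ q (digs x))

      Reachable : Fin nQ → Set
      Reachable q = ∃ λ w → foldl Δ q₀ w ≡ q

      val-run : ∀ {q} (r : Reachable q) es → τ (foldl Δ q es) ≡ f (digitsVal k (proj₁ r ++ es))
      val-run (w , refl) es = trans (cong τ (sym (foldl-++ Δ q₀ w es))) (sym (f-aut (w ++ es)))

      -- Prefixing a word that leads to q turns two representations of one number into
      -- representations of another common number, on which f takes a single value. This is where
      -- reachability is used.
      val-cong : ∀ {q} → Reachable q → ∀ es es′ → digitsVal k es ≡ digitsVal k es′ →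
                 τ (foldl Δ q es) ≡ τ (foldl Δ q es′)
      val-cong r es es′ eq = trans (val-run r es)
        (trans (cong f (digitsVal-++ (proj₁ r) eq)) (sym (val-run r es′)))

      val-step : ∀ {q} → Reachable q → ∀ d x → val q (d ⊕ x) ≡ val (Δ q d) x
      val-step r d x = val-cong r (digs (d ⊕ x)) (d ∷ digs x)
        (trans (proj₂ (digits (d ⊕ x))) (cong (d ⊕_) (sym (proj₂ (digits x)))))

      reach-step : ∀ {q} → Reachable q → ∀ d → Reachable (Δ q d)
      reach-step (w , refl) d = w ++ d ∷ [] , foldl-++ Δ q₀ w (d ∷ [])

    -- The two values are computed by independent runs and compared at the end, so any decidable
    -- relation is allowed. Taking i = j gives the predicates on a single letter.
    rel : ∀ {R : ℕ → ℕ → Set} (R? : ∀ u v → Dec (R u v)) {n} (i j : Fin n) →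
          Aut (λ x → R (f (lookup x i)) (f (lookup x j)))
    rel {R} R? {n} i j = record
      { finite = ×-finite (Fin-finite nQ) (Fin-finite nQ)
      ; δ = λ (q , q′) d → Δ q (lookup d i) , Δ q′ (lookup d j)
      ; start = q₀ , q₀
      ; Inv = λ (q , q′) → Reachable q × Reachable q′
      ; F = λ (q , q′) x → R (val q (lookup x i)) (val q′ (lookup x j))
      ; Acc = λ (q , q′) → R (τ q) (τ q′)
      ; Acc? = λ (q , q′) → R? (τ q) (τ q′)
      ; inv₀ = ([] , refl) , ([] , refl)
      ; invδ = λ (r , r′) d → reach-step r (lookup d i) , reach-step r′ (lookup d j)
      ; spec = λ x → same (start-val (lookup x i)) (start-val (lookup x j))
      ; step = λ (r , r′) d x → same (at i r d x) (at j r′ d x)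
      ; stop = λ (r , r′) → same (at0 i r) (at0 j r′)
      }
      where
      same : ∀ {u u′ v v′} → u ≡ u′ → v ≡ v′ → R u v ⟺ R u′ v′
      same refl refl = id , id
      start-val : ∀ x → f x ≡ val q₀ x
      start-val x = trans (cong f (sym (proj₂ (digits x)))) (f-aut (digs x))
      at : ∀ i {q} → Reachable q → ∀ d x → val q (lookup (d ⊞ x) i) ≡ val (Δ q (lookup d i)) (lookup x i)
      at i r d x rewrite lookup-zipWith _⊕_ i d x = val-step r (lookup d i) (lookup x i)
      at0 : ∀ i {q} → Reachable q → val q (lookup (0s {n}) i) ≡ τ q
      at0 i r rewrite lookup-replicate i 0 = val-cong r (digs 0) [] (proj₂ (digits 0))

  -- min(f , j+1) is j+1 where j < f and min(f , j) elsewhere.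
  automatic-from-levels : (f : ℕ → ℕ) → (∀ c → Aut {1} (λ x → c < f (lookup x zero))) →
                          ∀ j → (∀ x → f x ≤ j) → AutomaticFun f
  automatic-from-levels f level j f≤j =
    let (nQ , δ′ , q₀ , τ , eq) = go j
    in nQ , δ′ , q₀ , τ , λ ds → trans (sym (m≤n⇒m⊓n≡m (f≤j _))) (eq ds)
    where
    go : ∀ j → AutomaticFun (λ x → f x ⊓ j)
    go zero = 1 , (λ _ _ → zero) , zero , (λ _ → 0) , λ ds → ⊓-zeroʳ (f (digitsVal k ds))
    go (suc j) = size fin , Δ , index fin (start M , q₀) , out ∘ enum fin ,
                 λ ds → trans (run ds) (cong out (runs (start M , q₀) ds))
      where
      M = level j
      nQ = proj₁ (go j)
      δ′ = proj₁ (proj₂ (go j))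
      q₀ = proj₁ (proj₂ (proj₂ (go j)))
      τ = proj₁ (proj₂ (proj₂ (proj₂ (go j))))
      fin = ×-finite (finite M) (Fin-finite nQ)
      -- The product runs the automaton deciding j < f beside the one that outputs min(f , j).
      stp : State M × Fin nQ → Fin k → State M × Fin nQ
      stp (s , q) d = δ M s (d ∷ []) , δ′ q d
      Δ : Fin (size fin) → Fin k → Fin (size fin)
      Δ i d = index fin (stp (enum fin i) d)
      out : State M × Fin nQ → ℕ
      out (s , q) with Acc? M s
      ... | yes _ = suc j
      ... | no _  = τ q

      runs : ∀ s ds → foldl stp s ds ≡ enum fin (foldl Δ (index fin s) ds)
      runs s []       = sym (enum-index fin s)
      runs s (d ∷ ds) = trans (runs (stp s d) ds)
        (cong (λ t → enum fin (foldl Δ (index fin (stp t d)) ds)) (sym (enum-index fin s)))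

      accepts : ∀ {s} → Inv M s → ∀ q ds →
                (F M s (digitsVal k ds ∷ []) ⟺ Acc M (proj₁ (foldl stp (s , q) ds))) ×
                proj₂ (foldl stp (s , q) ds) ≡ foldl δ′ q ds
      accepts i q []       = stop M i , refl
      accepts i q (d ∷ ds) with step M i (d ∷ []) (digitsVal k ds ∷ []) | accepts (invδ M i (d ∷ [])) (δ′ q d) ds
      ... | (f , g) | (f′ , g′) , eq = ((f′ ∘ f) , (g ∘ g′)) , eq

      run : ∀ ds → f (digitsVal k ds) ⊓ suc j ≡ out (foldl stp (start M , q₀) ds)
      run ds with foldl stp (start M , q₀) ds | accepts (inv₀ M) q₀ ds
      ... | s , q | (to , from) , refl with Acc? M s
      ...   | yes a = m≥n⇒m⊓n≡n (proj₂ (spec M _) (from a))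
      ...   | no ¬a = trans (trans (m≤n⇒m⊓n≡m (≤-trans le (n≤1+n j))) (sym (m≤n⇒m⊓n≡m le)))
                            (proj₂ (proj₂ (proj₂ (proj₂ (go j)))) ds)
        where
        le : f (digitsVal k ds) ≤ j
        le = ≮⇒≥ λ j< → ¬a (to (proj₁ (spec M _) j<))

-- Recurrent values and the extremal recurrent word.

Even : ℕ → Set
Even i = ∃ λ j → j + j ≡ i

InfinitelyOften : (ℕ → Set) → Set
InfinitelyOften T = ∀ N → ∃ λ n → N < n × T n

-- Pigeonhole principle, made constructive by `dec`: the values are tried upwards from 0. A value
-- that stops occurring raises the threshold N, and passing K would leave `total` without a value.
least-recurrent : ∀ (T : ℕ → ℕ → Set) K →
  (∀ v → InfinitelyOften (λ n → T n v) ⊎ ∃ λ N → ¬ ∃ λ n → N < n × T n v) →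
  InfinitelyOften (λ n → ∃ λ v → v ≤ K × T n v) →
  ∃ λ v → InfinitelyOften (λ n → T n v) × ∃ λ N → ∀ n → N < n → ∀ w → w < v → ¬ T n w
least-recurrent T K dec total = go (suc K) 0 (+-identityʳ (suc K)) (0 , λ _ _ _ ())
  where
  go : ∀ fuel v → fuel + v ≡ suc K → (∃ λ N → ∀ n → N < n → ∀ w → w < v → ¬ T n w) →
       ∃ λ v → InfinitelyOften (λ n → T n v) × ∃ λ N → ∀ n → N < n → ∀ w → w < v → ¬ T n w
  go zero v refl (N , none) with total N
  ... | n , N<n , w , w≤K , t = ⊥-elim (none n N<n w (s≤s w≤K) t)
  go (suc fuel) v eq (N , none) with dec v
  ... | inj₁ rec      = v , rec , N , none
  ... | inj₂ (M , ¬t) = go fuel (suc v) (trans (+-suc fuel v) eq) (N ⊔ M , λ n lt w w≤v t →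
    case-≤ n lt (m≤n⇒m<n∨m≡n (≤-pred w≤v)) t)
    where
    case-≤ : ∀ n → N ⊔ M < n → ∀ {w} → w < v ⊎ w ≡ v → ¬ T n w
    case-≤ n lt (inj₁ w<v)  t = none n (m⊔n<o⇒m<o N M lt) _ w<v t
    case-≤ n lt (inj₂ refl) t = ¬t (n , m⊔n<o⇒n<o N M lt , t)

-- The rankings `r₀` and `r₁` order the letters at even and at odd places of a window. Reversing one
-- or the other turns the same construction into the lim inf or the lim sup word.
module Extremal (k₀ : ℕ) {A : ℕ → ℕ} (A-aut : Büchi.AutomaticFun k₀ A) {B : ℕ} (A≤B : ∀ x → A x ≤ B)
  (r₀ r₁ : ℕ → ℕ)
  (r₀≤ : ∀ {u} → u ≤ B → r₀ u ≤ B) (r₁≤ : ∀ {u} → u ≤ B → r₁ u ≤ B)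
  (r₀-inj : ∀ {u v} → u ≤ B → v ≤ B → r₀ u ≡ r₀ v → u ≡ v)
  (r₁-inj : ∀ {u v} → u ≤ B → v ≤ B → r₁ u ≡ r₁ v → u ≡ v)
  where

  open Büchi k₀

  -- Positions are given by `x + i ≡ n` rather than `n ∸ i`, so that the predicate is a formula over
  -- addition. Places beyond the start of the sequence agree vacuously.
  Agree : ℕ → ℕ → ℕ → Set
  Agree l n n′ = ∀ i x y → i < l → x + i ≡ n → y + i ≡ n′ → A x ≡ A y

  Beats : ℕ → ℕ → ℕ → Set
  Beats i x y = (Even i × r₀ (A x) < r₀ (A y)) ⊎ (¬ Even i × r₁ (A x) < r₁ (A y))

  -- Alternating lexicographic order on the windows of length l ending at n and at n′, read
  -- backwards; meaningful only if l does not exceed n and n′.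
  Less : ℕ → ℕ → ℕ → Set
  Less l n n′ = ∃ λ i → ∃ λ x → ∃ λ y →
    i < l × x + i ≡ n × y + i ≡ n′ × Agree i n n′ × Beats i x y

  Minimal : ℕ → ℕ → Set
  Minimal l n = ∃ λ N → ∀ n′ → N < n′ → ¬ Less l n′ n

  Recurrent : ℕ → ℕ → Set
  Recurrent l n = InfinitelyOften (Agree l n)

  Optimal : ℕ → ℕ → Set
  Optimal l n = l < n × Recurrent l n × Minimal l n

  -- The first-order formula for "letter m of the extremal word exceeds c"; it quantifies over
  -- optimal windows instead of selecting one.
  Above : ℕ → ℕ → Set
  Above c m = ∃ λ l → ∃ λ n → ∃ λ x → m < l × Optimal l n × x + m ≡ n × c < A x

  private
    variable
      r : ℕ

  -- Automata for these formulas.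

  abstract
    even : (i : Fin r) → Aut (λ ρ → Even (lookup ρ i))
    even i = ex (sum 0F 0F (suc i))

    agree : (l n n′ : Fin r) → Aut (λ ρ → Agree (lookup ρ l) (lookup ρ n) (lookup ρ n′))
    -- The bound variables i, x, y get the indices 2F, 1F, 0F, and the free ones are shifted by
    -- three.
    agree l n n′ = all (all (all
      (lt 2F (suc (suc (suc l))) imp sum 1F 2F (suc (suc (suc n))) imp
       sum 0F 2F (suc (suc (suc n′))) imp rel {A} A-aut _≟_ 1F 0F)))

    beats : (i x y : Fin r) → Aut (λ ρ → Beats (lookup ρ i) (lookup ρ x) (lookup ρ y))
    beats i x y = even i and rel {A} A-aut (λ u v → r₀ u <? r₀ v) x y
               or not′ (even i) and rel {A} A-aut (λ u v → r₁ u <? r₁ v) x y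

    less : (l n n′ : Fin r) → Aut (λ ρ → Less (lookup ρ l) (lookup ρ n) (lookup ρ n′))
    less l n n′ = ex (ex (ex
      (lt 2F (suc (suc (suc l))) and sum 1F 2F (suc (suc (suc n))) and
       sum 0F 2F (suc (suc (suc n′))) and
       agree 2F (suc (suc (suc n))) (suc (suc (suc n′))) and beats 2F 1F 0F)))

    minimal : (l n : Fin r) → Aut (λ ρ → Minimal (lookup ρ l) (lookup ρ n))
    minimal l n = ex (all (lt 1F 0F imp not′ (less (suc (suc l)) 0F (suc (suc n)))))

    recurrent : (l n : Fin r) → Aut (λ ρ → Recurrent (lookup ρ l) (lookup ρ n))
    recurrent l n = all (ex (lt 1F 0F and agree (suc (suc l)) (suc (suc n)) 0F))

    optimal : (l n : Fin r) → Aut (λ ρ → Optimal (lookup ρ l) (lookup ρ n))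
    optimal l n = lt l n and recurrent l n and minimal l n

    above : ∀ c (m : Fin r) → Aut (λ ρ → Above c (lookup ρ m))
    above c m = ex (ex (ex
      (lt (suc (suc (suc m))) 2F and optimal 2F 1F and
       sum 0F (suc (suc (suc m))) 1F and rel {A} A-aut (λ u _ → c <? u) 0F 0F)))

  -- Takes the place of excluded middle for statements quantified over all numbers.
  always-or-counterexample : {P : Vec ℕ (suc r) → Set} → Aut P → ∀ ρ →
                             (∀ y → P (y ∷ ρ)) ⊎ ∃ λ y → ¬ P (y ∷ ρ)
  always-or-counterexample M ρ with decide (ex (not′ M)) ρ
  ... | yes c = inj₂ c
  ... | no ¬c = inj₁ λ y → decidable-stable (decide M (y ∷ ρ)) λ ¬p → ¬c (y , ¬p)

  abstract
    even? : ∀ i → Dec (Even i)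
    even? i = decide (even 0F) (i ∷ [])

  rank : ℕ → ℕ → ℕ
  rank i u with even? i
  ... | yes _ = r₀ u
  ... | no _  = r₁ u

  rank≤ : ∀ i {u} → u ≤ B → rank i u ≤ B
  rank≤ i with even? i
  ... | yes _ = r₀≤
  ... | no _  = r₁≤

  rank-inj : ∀ i {x y} → rank i (A x) ≡ rank i (A y) → A x ≡ A y
  rank-inj i with even? i
  ... | yes _ = r₀-inj (A≤B _) (A≤B _)
  ... | no _  = r₁-inj (A≤B _) (A≤B _)

  beats⇒rank< : ∀ i {x y} → Beats i x y → rank i (A x) < rank i (A y)
  beats⇒rank< i b with even? i | b
  ... | yes _ | inj₁ (_ , h)  = h
  ... | yes e | inj₂ (¬e , _) = ⊥-elim (¬e e)
  ... | no ¬e | inj₁ (e , _)  = ⊥-elim (¬e e)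
  ... | no _  | inj₂ (_ , h)  = h

  rank<⇒beats : ∀ i {x y} → rank i (A x) < rank i (A y) → Beats i x y
  rank<⇒beats i h with even? i
  ... | yes e = inj₁ (e , h)
  ... | no ¬e = inj₂ (¬e , h)

  beats-cong : ∀ i {x x′ y y′} → A x ≡ A x′ → A y ≡ A y′ → Beats i x y → Beats i x′ y′
  beats-cong i eq eq′ b =
    rank<⇒beats i (subst₂ (λ u v → rank i u < rank i v) eq eq′ (beats⇒rank< i b))

  agree-sym : ∀ {l n n′} → Agree l n n′ → Agree l n′ n
  agree-sym ag i x y i<l ex ey = sym (ag i y x i<l ey ex)

  -- The middle window must have all l letters: at a place missing from it both agreements would be
  -- vacuous and nothing would link n with n″.
  agree-trans : ∀ {l n n′ n″} → l ≤ n′ → Agree l n n′ → Agree l n′ n″ → Agree l n n″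
  agree-trans l≤n′ ag ag′ i x y i<l ex ey =
    trans (ag i x _ i<l ex (m∸n+n≡m i≤n′)) (ag′ i _ y i<l (m∸n+n≡m i≤n′) ey)
    where i≤n′ = ≤-trans (<⇒≤ i<l) l≤n′

  agree-shorten : ∀ {l l′ n n′} → l′ ≤ l → Agree l n n′ → Agree l′ n n′
  agree-shorten l′≤l ag i x y i<l′ = ag i x y (≤-trans i<l′ l′≤l)

  agree-extend : ∀ {l n n′ x y} → Agree l n n′ → x + l ≡ n → y + l ≡ n′ → A x ≡ A y →
                 Agree (suc l) n n′
  agree-extend {l} {x = x} {y} ag ex ey eq i x′ y′ i<sl ex′ ey′ with m≤n⇒m<n∨m≡n (≤-pred i<sl)
  ... | inj₁ i<l  = ag i x′ y′ i<l ex′ ey′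
  ... | inj₂ refl = subst₂ (λ u v → A u ≡ A v)
    (+-cancelʳ-≡ l x x′ (trans ex (sym ex′))) (+-cancelʳ-≡ l y y′ (trans ey (sym ey′))) eq

  -- Existence and uniqueness of optimal windows.

  Extension : ℕ → ℕ → ℕ → ℕ → Set
  Extension l n n′ v = Agree l n n′ × ∃ λ x → x + l ≡ n′ × rank l (A x) ≡ v

  abstract
    -- For fixed l, n and v, recurrence of the extension is itself a first-order statement, hence
    -- decidable; this supplies `dec` in `least-recurrent`.
    extension-recurs? : ∀ l n v → InfinitelyOften (λ n′ → Extension l n n′ v) ⊎
                        ∃ λ N → ¬ ∃ λ n′ → N < n′ × Extension l n n′ v
    extension-recurs? l n v = always-or-counterexample
      (ex (lt 1F 0F and agree 2F 3F 0F and
        ex (sum 0F 3F 1F and rel {A} A-aut (λ u _ → rank l u ≟ v) 0F 0F)))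
      (l ∷ n ∷ [])

  -- Among the letters that follow the optimal window infinitely often, take one of least rank. A
  -- later window that is less than the new one differs from it either inside the old window,
  -- against the old minimality, or at the new letter, against the choice of the rank.
  optimal-extension : ∀ l n → Optimal l n → ∃ (Optimal (suc l))
  optimal-extension l n (l<n , rec , (N₁ , min)) with
    least-recurrent (Extension l n) B (extension-recurs? l n)
      (λ N → let (n′ , lt , ag) = rec (N ⊔ l)
            in n′ , m⊔n<o⇒m<o N l lt , _ , rank≤ l (A≤B _) , ag , n′ ∸ l ,
               m∸n+n≡m (<⇒≤ (m⊔n<o⇒n<o N l lt)) , refl)
  ... | v , v-rec , (N₂ , none) with v-rec (suc l)
  -- The occurrence is taken beyond `suc l`, so that the longer window fits before n₁.
  ...   | n₁ , l<n₁ , ag₁ , x₁ , ex₁ , v≡ = n₁ , l<n₁ , rec₁ , N₁ ⊔ N₂ , min₁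
    where
    rec₁ : Recurrent (suc l) n₁
    rec₁ N with v-rec N
    ... | n′ , N<n′ , ag , x , ex , eq = n′ , N<n′ ,
      agree-extend (agree-trans (<⇒≤ l<n) (agree-sym ag₁) ag) ex₁ ex (rank-inj l (trans v≡ (sym eq)))

    min₁ : ∀ n′ → N₁ ⊔ N₂ < n′ → ¬ Less (suc l) n′ n₁
    min₁ n′ lt (i , x , y , i<sl , ex , ey , ag , bt) with m≤n⇒m<n∨m≡n (≤-pred i<sl)
    ... | inj₁ i<l = min n′ (m⊔n<o⇒m<o N₁ N₂ lt)
      (i , x , n ∸ i , i<l , ex , ez
      , agree-trans (≤-trans (<⇒≤ i<sl) (<⇒≤ l<n₁)) ag (agree-sym (agree-shorten (<⇒≤ i<l) ag₁))
      , beats-cong i refl (sym (ag₁ i _ y i<l ez ey)) bt)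
      where ez = m∸n+n≡m (<⇒≤ (<-trans i<l l<n))
    ... | inj₂ refl = none n′ (m⊔n<o⇒n<o N₁ N₂ lt) (rank l (A x))
      (subst (rank l (A x) <_)
        (trans (cong (rank l ∘ A) (+-cancelʳ-≡ l y x₁ (trans ey (sym ex₁)))) v≡) (beats⇒rank< l bt))
      (agree-trans (≤-trans (n≤1+n l) (<⇒≤ l<n₁)) ag₁ (agree-sym ag) , x , ex , refl)

  abstract
    optimal-exists : ∀ l → ∃ (Optimal l)
    optimal-exists zero = 1 , s≤s z≤n , (λ N → suc N , ≤-refl , λ _ _ _ ())
                            , 0 , λ { _ _ (_ , _ , _ , () , _) }
    optimal-exists (suc l) with optimal-exists l
    ... | n , opt = optimal-extension l n opt

  -- The window at n recurs, so if it beat the one at n′ there would be arbitrarily late windows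
  -- less than that at n′, against the minimality of n′.
  not-beaten : ∀ {l n l′ n′ m x y} → Optimal l n → Optimal l′ n′ → m < l → m < l′ →
               Agree m n n′ → x + m ≡ n → y + m ≡ n′ → ¬ Beats m x y
  not-beaten {m = m} (l<n , rec , _) (_ , _ , N , min) m<l m<l′ ag ex ey bt with rec (N ⊔ m)
  ... | n″ , lt , ag′ = min n″ (m⊔n<o⇒m<o N m lt)
    (m , n″ ∸ m , _ , m<l′ , ex″ , ey
    , agree-trans (≤-trans (<⇒≤ m<l) (<⇒≤ l<n)) (agree-sym (agree-shorten (<⇒≤ m<l) ag′)) ag
    , beats-cong m (ag′ m _ _ m<l ex ex″) refl bt)
    where ex″ = m∸n+n≡m (<⇒≤ (m⊔n<o⇒n<o N m lt))

  -- At a first place of disagreement the ranks differ by injectivity and one window would beat the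
  -- other. Hence optimal windows of all lengths are prefixes of one infinite word.
  optimal-unique : ∀ {l n l′ n′} → Optimal l n → Optimal l′ n′ → ∀ m → m < l → m < l′ →
                   ∀ x y → x + m ≡ n → y + m ≡ n′ → A x ≡ A y
  optimal-unique {l} {n} {l′} {n′} opt opt′ = <-rec _ go
    where
    go : ∀ m → (∀ {j} → j < m → j < l → j < l′ → ∀ x y → x + j ≡ n → y + j ≡ n′ → A x ≡ A y) →
         m < l → m < l′ → ∀ x y → x + m ≡ n → y + m ≡ n′ → A x ≡ A y
    go m ih m<l m<l′ x y ex ey with <-cmp (rank m (A x)) (rank m (A y))
    ... | tri≈ _ eq _ = rank-inj m eq
    ... | tri< h _ _ = ⊥-elim (not-beaten opt opt′ m<l m<l′ ag ex ey (rank<⇒beats m h))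
      where
      ag : Agree m n n′
      ag j x y j<m = ih j<m (<-trans j<m m<l) (<-trans j<m m<l′) x y
    ... | tri> _ _ h = ⊥-elim (not-beaten opt′ opt m<l′ m<l (agree-sym ag) ey ex (rank<⇒beats m h))
      where
      ag : Agree m n n′
      ag j x y j<m = ih j<m (<-trans j<m m<l) (<-trans j<m m<l′) x y

  end : ℕ → ℕ
  end l = proj₁ (optimal-exists l)

  end-optimal : ∀ l → Optimal l (end l)
  end-optimal l = proj₂ (optimal-exists l)

  -- By `optimal-unique`, any optimal window longer than m has this letter at place m, so the
  -- selected ends need not be compatible with each other.
  extremal : ℕ → ℕ
  extremal m = A (end (suc m) ∸ m)

  optimal-extremal : ∀ {l n} → Optimal l n → ∀ m → m < l → ∀ x → x + m ≡ n → A x ≡ extremal m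
  optimal-extremal opt m m<l x ex = optimal-unique opt (end-optimal (suc m)) m m<l ≤-refl x _ ex
    (m∸n+n≡m (≤-trans (n≤1+n m) (<⇒≤ (proj₁ (end-optimal (suc m))))))

  extremal≤ : ∀ m → extremal m ≤ B
  extremal≤ m = A≤B _

  extremal-automatic : AutomaticFun extremal
  extremal-automatic = automatic-from-levels extremal level B extremal≤
    where
    level : ∀ c → Aut (λ ρ → c < extremal (lookup ρ 0F))
    level c = transport (λ ρ →
        (λ (l , n , x , m<l , opt , ex , c<) → subst (c <_) (optimal-extremal opt _ m<l x ex) c<)
      , (λ c< → _ , _ , _ , ≤-refl , end-optimal _ ,
           m∸n+n≡m (≤-trans (n≤1+n _) (<⇒≤ (proj₁ (end-optimal _)))) , c<))
      (above c 0F)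

  extremal-recurs : ∀ l → InfinitelyOften (λ n → l < n × ∀ i → i < l → A (n ∸ i) ≡ extremal i)
  extremal-recurs l N with end-optimal l
  ... | opt@(l<n , rec , _) with rec (N ⊔ l)
  ...   | n′ , lt , ag = n′ , m⊔n<o⇒m<o N l lt , m⊔n<o⇒n<o N l lt , λ i i<l →
    trans (sym (ag i (end l ∸ i) (n′ ∸ i) i<l (m∸n+n≡m (<⇒≤ (<-trans i<l l<n)))
                   (m∸n+n≡m (<⇒≤ (<-trans i<l (m⊔n<o⇒n<o N l lt))))))
          (optimal-extremal opt i i<l _ (m∸n+n≡m (<⇒≤ (<-trans i<l l<n))))

  extremal-minimal : ∀ l → ∃ λ N → ∀ n → N < n → ¬ ∃ λ i → i < l × (∀ j → j < i → A (n ∸ j) ≡ extremal j) ×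
    ((Even i × r₀ (A (n ∸ i)) < r₀ (extremal i)) ⊎ (¬ Even i × r₁ (A (n ∸ i)) < r₁ (extremal i)))
  extremal-minimal l with end-optimal l
  -- Going beyond l as well makes every subtraction `n ∸ i` exact.
  ... | opt@(l<n₀ , _ , N , min) = N ⊔ l , λ { n lt (i , i<l , eqs , bt) →
    let i≤n = <⇒≤ (<-trans i<l (m⊔n<o⇒n<o N l lt))
        ey  = m∸n+n≡m (<⇒≤ (<-trans i<l l<n₀))
    in min n (m⊔n<o⇒m<o N l lt)
      (i , n ∸ i , end l ∸ i , i<l , m∸n+n≡m i≤n , ey
      , (λ j x y j<i ex ey′ → trans (cong A (trans (sym (m+n∸n≡m x j)) (cong (_∸ j) ex)))
                               (trans (eqs j j<i) (sym (optimal-extremal opt j (<-trans j<i i<l) y ey′))))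
      , subst (λ u → (Even i × r₀ (A (n ∸ i)) < r₀ u) ⊎ (¬ Even i × r₁ (A (n ∸ i)) < r₁ u))
              (sym (optimal-extremal opt i i<l _ ey)) bt) }

-- The alternating lexicographic order on prefixes.

even-suc : ∀ {i} → Even i → ¬ Even (suc i)
even-suc (j , refl) (m , eq) = even≢odd m j
  (trans (cong (λ t → m + t) (+-identityʳ m)) (trans eq (cong (λ t → suc (j + t)) (sym (+-identityʳ j)))))

¬even⇒even-suc : ∀ {i} → ¬ Even i → Even (suc i)
¬even⇒even-suc {i} ¬e with parity i
  where
  parity : ∀ i → Even i ⊎ Even (suc i)
  parity zero = inj₁ (0 , refl)
  parity (suc i) with parity i
  ... | inj₁ (j , eq) = inj₂ (suc j , trans (cong suc (+-suc j j)) (cong (λ t → suc (suc t)) eq))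
  ... | inj₂ e = inj₁ e
... | inj₁ e = ⊥-elim (¬e e)
... | inj₂ e = e

-- Exchanging the two words in the recursive call produces the alternation.
LexLe : ℕ → (ℕ → ℕ) → (ℕ → ℕ) → Set
LexLe zero    f g = ⊤
LexLe (suc l) f g = f 0 < g 0 ⊎ (f 0 ≡ g 0 × LexLe l (g ∘ suc) (f ∘ suc))

FirstDifferenceAbove : ℕ → (ℕ → ℕ) → (ℕ → ℕ) → Set
FirstDifferenceAbove l f g = ∃ λ i → i < l × (∀ j → j < i → f j ≡ g j) ×
  ((Even i × g i < f i) ⊎ (¬ Even i × f i < g i))

¬above⇒lexLe : ∀ l f g → ¬ FirstDifferenceAbove l f g → LexLe l f g
¬above⇒lexLe zero    f g h = tt
¬above⇒lexLe (suc l) f g h with <-cmp (f 0) (g 0)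
... | tri< lt _ _ = inj₁ lt
... | tri> _ _ gt = ⊥-elim (h (0 , s≤s z≤n , (λ _ ()) , inj₁ ((0 , refl) , gt)))
... | tri≈ _ eq _ = inj₂ (eq , ¬above⇒lexLe l (g ∘ suc) (f ∘ suc) λ { (i , i<l , eqs , d) →
    h (suc i , s≤s i<l , (λ { zero _ → eq ; (suc j) (s≤s j<i) → sym (eqs j j<i) })
      -- Removing the first place changes the parity of i while the words are exchanged, so the two
      -- cases trade places.
      , Sum.swap (Sum.map (λ (e , lt) → even-suc e , lt) (λ (¬e , lt) → ¬even⇒even-suc ¬e , lt) d)) })

agree⇒lexLe : ∀ l f g → (∀ i → i < l → f i ≡ g i) → LexLe l f g
agree⇒lexLe zero    f g eq = tt
agree⇒lexLe (suc l) f g eq =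
  inj₂ (eq 0 (s≤s z≤n) , agree⇒lexLe l (g ∘ suc) (f ∘ suc) λ i i<l → sym (eq (suc i) (s≤s i<l)))

-- Continuants built from the front, and their agreement with the standard recurrences.

num den : (ℕ → ℕ) → ℕ → ℕ
num b zero    = 1
num b (suc l) = b 0 * num (b ∘ suc) l + den (b ∘ suc) l
den b zero    = 0
den b (suc l) = num (b ∘ suc) l

-- Numerators and denominators are entries of a product of matrices with rows (cᵢ , 1) and (1 , 0).
-- The recurrences append a factor on the right; here the first factor is split off on the left.
P-front : ∀ c n → P c (suc n) ≡ c 0 ℤ.* P (c ∘ suc) n ℤ.+ Q (c ∘ suc) n
P-front c zero          = sym (cong (ℤ._+ + 1) (ℤ.*-zeroʳ (c 0)))
P-front c (suc zero)    = refl
P-front c (suc (suc n)) =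
  trans (cong₂ (λ u v → c (suc n) ℤ.* u ℤ.+ v) (P-front c (suc n)) (P-front c n))
        (lemma (c 0) (c (suc n)) (P (c ∘ suc) (suc n)) (Q (c ∘ suc) (suc n)) (P (c ∘ suc) n) (Q (c ∘ suc) n))
  where
  lemma : ∀ c d x y z w → d ℤ.* (c ℤ.* x ℤ.+ y) ℤ.+ (c ℤ.* z ℤ.+ w) ≡
                          c ℤ.* (d ℤ.* x ℤ.+ z) ℤ.+ (d ℤ.* y ℤ.+ w)
  lemma = ℤ-Solver.solve-∀

Q-front : ∀ c n → Q c (suc n) ≡ P (c ∘ suc) n
Q-front c zero          = refl
Q-front c (suc zero)    = cong (ℤ._+ + 1) (ℤ.*-zeroʳ (c 0))
Q-front c (suc (suc n)) = cong₂ (λ u v → c (suc n) ℤ.* u ℤ.+ v) (Q-front c (suc n)) (Q-front c n)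

P≡num : ∀ b l → P (+_ ∘ b) (suc l) ≡ + num b l
Q≡den : ∀ b l → Q (+_ ∘ b) (suc l) ≡ + den b l
P≡num b zero    = refl
P≡num b (suc l) = trans (P-front (+_ ∘ b) (suc l)) (trans
  (cong₂ (λ u v → + b 0 ℤ.* u ℤ.+ v) (P≡num (b ∘ suc) l) (Q≡den (b ∘ suc) l))
  (cong (ℤ._+ + den (b ∘ suc) l) (sym (ℤ.pos-* (b 0) _))))
Q≡den b zero    = refl
Q≡den b (suc l) = trans (Q-front (+_ ∘ b) (suc l)) (P≡num (b ∘ suc) l)

conv≡ : ∀ b m → conv (+_ ∘ b) m ≡ frac (+ num b (suc m)) (+ den b (suc m))
conv≡ b m = cong₂ frac (P≡num b (suc m)) (Q≡den b (suc m))

num≥1 : ∀ {b} → (∀ i → 1 ≤ b i) → ∀ l → 1 ≤ num b l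
num≥1 b≥1 zero    = ≤-refl
num≥1 b≥1 (suc l) = ≤-trans (*-mono-≤ (b≥1 0) (num≥1 (b≥1 ∘ suc) l)) (m≤m+n _ _)

den≤num : ∀ {b} → (∀ i → 1 ≤ b i) → ∀ l → den b l ≤ num b l
den≤num b≥1 zero = z≤n
den≤num {b} b≥1 (suc l) = ≤-trans (≤-reflexive (sym (*-identityˡ (num (b ∘ suc) l))))
  (≤-trans (*-monoˡ-≤ (num (b ∘ suc) l) (b≥1 0)) (m≤m+n _ _))

frac-≤ : ∀ {u v u′ v′} → 1 ≤ v → 1 ≤ v′ → u * v′ ≤ u′ * v → frac (+ u) (+ v) ℚ.≤ frac (+ u′) (+ v′)
frac-≤ {u} {suc v} {u′} {suc v′} _ _ le =
  *≤* (subst₂ ℤ._≤_ (ℤ.pos-* u (suc v′)) (ℤ.pos-* u′ (suc v)) (ℤ.+≤+ le))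

-- c + v/u ≤ d ≤ d + t/w when v ≤ u.
head-< : ∀ {c d u v} w t → c < d → v ≤ u → (c * u + v) * w ≤ (d * w + t) * u
head-< {c} {d} {u} {v} w t c<d v≤u = begin
  (c * u + v) * w ≤⟨ *-monoˡ-≤ w (+-monoʳ-≤ (c * u) v≤u) ⟩
  (c * u + u) * w ≡⟨ lemma c u w ⟩
  suc c * (w * u) ≤⟨ *-monoˡ-≤ (w * u) c<d ⟩
  d * (w * u)     ≡⟨ *-assoc d w u ⟨
  d * w * u       ≤⟨ *-monoˡ-≤ u (m≤m+n (d * w) t) ⟩
  (d * w + t) * u ∎
  where
  open ≤-Reasoning
  lemma : ∀ c u w → (c * u + u) * w ≡ suc c * (w * u)
  lemma = solve-∀

-- With equal first letters, c + v/u ≤ c + t/w amounts to the reversed comparison w/t ≤ u/v of the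
-- tails.
head-≡ : ∀ c u v w t → w * v ≤ u * t → (c * u + v) * w ≤ (c * w + t) * u
head-≡ c u v w t le = begin
  (c * u + v) * w         ≡⟨ lemma c u v w ⟩
  c * (u * w) + w * v     ≤⟨ +-monoʳ-≤ (c * (u * w)) le ⟩
  c * (u * w) + u * t     ≡⟨ lemma′ c u w t ⟩
  (c * w + t) * u         ∎
  where
  open ≤-Reasoning
  lemma : ∀ c u v w → (c * u + v) * w ≡ c * (u * w) + w * v
  lemma = solve-∀
  lemma′ : ∀ c u w t → c * (u * w) + u * t ≡ (c * w + t) * u
  lemma′ = solve-∀

-- Comparing the ratios with convergents.

double : ℕ → ℕ
double zero    = zero
double (suc j) = suc (suc (double j))

n≤double : ∀ n → n ≤ double n
n≤double zero    = z≤n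
n≤double (suc n) = s≤s (≤-trans (n≤double n) (n≤1+n _))

-- The common features of the p and q ratios: from n₀ on, y is a positive nondecreasing solution of
-- the recurrence, so y (n+2) / y (n+1) begins with the partial quotients A n, A (n-1), and so on.
-- Starting at n₀ skips initial zeros and signs.
record Ratios (A : ℕ → ℕ) (s : ℕ → ℚᵘ) : Set where
  field
    n₀    : ℕ
    y     : ℕ → ℕ
    rec   : ∀ n → n₀ ≤ n → y (suc (suc n)) ≡ A n * y (suc n) + y n
    pos   : ∀ n → n₀ ≤ n → 1 ≤ y n
    mono  : ∀ n → n₀ ≤ n → y n ≤ y (suc n)
    ratio : ∀ n → n₀ ≤ n → s n ≡ frac (+ y (suc (suc (suc n)))) (+ y (suc (suc n)))

module Comparison {A : ℕ → ℕ} {s : ℕ → ℚᵘ} (R : Ratios A s) where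
  open Ratios R

  window : ℕ → ℕ → ℕ
  window n i = A (n ∸ i)

  -- Prepending a partial quotient c acts by x ↦ c + 1/x, which reverses the order, so the two
  -- bounds alternate; the tail (1 , 0) = ∞ of the convergent makes the even one start trivially.
  window-even : ∀ j n b → (∀ i → 1 ≤ b i) → n₀ + double j ≤ n → LexLe (double j) (window n) b →
                y (suc (suc n)) * den b (double j) ≤ num b (double j) * y (suc n)
  window-odd : ∀ j n b → (∀ i → 1 ≤ b i) → n₀ + suc (double j) ≤ n → LexLe (suc (double j)) b (window n) →
               num b (suc (double j)) * y (suc n) ≤ y (suc (suc n)) * den b (suc (double j))

  window-even zero n b b≥1 le lex = ≤-trans (≤-reflexive (*-zeroʳ (y (suc (suc n))))) z≤n
  window-even (suc j) n b b≥1 le lex rewrite +-suc n₀ (suc (double j)) with n | le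
  ... | suc n | s≤s le′ rewrite rec (suc n) (≤-trans (≤-trans (m≤m+n n₀ _) le′) (n≤1+n n)) with lex
  ...   | inj₁ lt = head-< _ _ lt (mono (suc n) (≤-trans (≤-trans (m≤m+n n₀ _) le′) (n≤1+n n)))
  ...   | inj₂ (eq , lex′) rewrite eq = head-≡ (b 0) _ _ _ _ (window-odd j n (b ∘ suc) (b≥1 ∘ suc) le′ lex′)

  window-odd j n b b≥1 le lex rewrite +-suc n₀ (double j) with n | le
  ... | suc n | s≤s le′ rewrite rec (suc n) (≤-trans (≤-trans (m≤m+n n₀ _) le′) (n≤1+n n)) with lex
  ...   | inj₁ lt = head-< _ _ lt (den≤num (b≥1 ∘ suc) (double j))
  ...   | inj₂ (eq , lex′) rewrite eq = head-≡ (window (suc n) 0) _ _ _ _ (window-even j n (b ∘ suc) (b≥1 ∘ suc) le′ lex′)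

  module _ (b : ℕ → ℕ) (b≥1 : ∀ i → 1 ≤ b i) where

    -- The expansion of `s n` starts with A (n+1), hence the window at `suc n`. The convergent of
    -- index `suc (double j)` has `double (suc j)` letters, an even number, so it bounds from above.
    ratio≤conv : ∀ j n → n₀ + double (suc j) ≤ suc n → LexLe (double (suc j)) (window (suc n)) b →
                 s n ℚ.≤ conv (+_ ∘ b) (suc (double j))
    ratio≤conv j n le lex rewrite conv≡ b (suc (double j))
      | ratio n (≤-pred (≤-trans (≤-reflexive (sym (+-comm n₀ 1))) (≤-trans (+-monoʳ-≤ n₀ (s≤s z≤n)) le))) =
      frac-≤ (pos _ (≤-trans (≤-trans (m≤m+n n₀ _) le) (n≤1+n _))) (num≥1 (b≥1 ∘ suc) (suc (double j)))
             (window-even (suc j) (suc n) b b≥1 le lex)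

    conv≤ratio : ∀ j n → n₀ + suc (double j) ≤ suc n → LexLe (suc (double j)) b (window (suc n)) →
                 conv (+_ ∘ b) (double j) ℚ.≤ s n
    conv≤ratio j n le lex rewrite conv≡ b (double j)
      | ratio n (≤-pred (≤-trans (≤-reflexive (sym (+-comm n₀ 1))) (≤-trans (+-monoʳ-≤ n₀ (s≤s z≤n)) le))) =
      frac-≤ (num≥1 (b≥1 ∘ suc) (double j)) (pos _ (≤-trans (≤-trans (m≤m+n n₀ _) le) (n≤1+n _)))
             (window-odd j (suc n) b b≥1 le lex)

    Recurs : Set
    Recurs = ∀ l → InfinitelyOften (λ n → l < n × ∀ i → i < l → window n i ≡ b i)

    gap-below⇒< : ∀ {r ε x y} → 0ℚᵘ ℚ.< ε → r ℚ.+ ε ℚ.≤ x → x ℚ.≤ y → r ℚ.< y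
    gap-below⇒< {r} 0<ε le le′ = ℚ.<-≤-trans
      (ℚ.<-respˡ-≃ (ℚ.+-identityʳ r) (ℚ.+-monoʳ-< r 0<ε)) (ℚ.≤-trans le le′)

    gap-above⇒< : ∀ {r ε x y} → 0ℚᵘ ℚ.< ε → x ℚ.+ ε ℚ.≤ r → y ℚ.≤ x → y ℚ.< r
    gap-above⇒< {r} {x = x} 0<ε le le′ = ℚ.≤-<-trans le′ (ℚ.<-≤-trans
      (ℚ.<-respˡ-≃ (ℚ.+-identityʳ x) (ℚ.+-monoʳ-< x 0<ε)) le)

    recurs-at : Recurs → ∀ l N → ∃ λ n → N ≤ n × n₀ + l ≤ suc n × ∀ i → i < l → window (suc n) i ≡ b i
    recurs-at recurs l N with recurs l (N + (n₀ + l))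
    ... | suc n , s≤s lt , _ , eq = n , m+n≤o⇒m≤o N lt , ≤-trans (m+n≤o⇒n≤o N lt) (n≤1+n n) , eq

    -- If r lies below b by a gap, it lies below a late convergent of even index, and this
    -- convergent is eventually a lower bound for the ratios. If r lies above b, a late convergent
    -- of odd index lies below r and bounds the ratios wherever a long prefix of b recurs.
    liminf : Recurs → (∀ l → ∃ λ N → ∀ n → N < n → LexLe l b (window n)) → IsLiminf s (+_ ∘ b)
    liminf recurs lower = below , above
      where
      below : ∀ r → r <CF (+_ ∘ b) → ∃ λ N → ∀ n → N ≤ n → r ℚ.< s n
      below r (ε , 0<ε , M , h) with lower (suc (double M))
      ... | N , lex = N + (n₀ + suc (double M)) , λ n le → gap-below⇒< 0<ε (h (double M) (n≤double M))
        (conv≤ratio M n (≤-trans (m+n≤o⇒n≤o N le) (n≤1+n n)) (lex (suc n) (s≤s (m+n≤o⇒m≤o N le))))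
      above : ∀ r → (+_ ∘ b) CF< r → ∀ N → ∃ λ n → N ≤ n × s n ℚ.< r
      above r (ε , 0<ε , M , h) N with recurs-at recurs (double (suc M)) N
      ... | n , N≤n , le , eq = n , N≤n , gap-above⇒< 0<ε (h (suc (double M)) (≤-trans (n≤double M) (n≤1+n _)))
        (ratio≤conv M n le (agree⇒lexLe (double (suc M)) (window (suc n)) b eq))

    limsup : Recurs → (∀ l → ∃ λ N → ∀ n → N < n → LexLe l (window n) b) → IsLimsup s (+_ ∘ b)
    limsup recurs upper = above , below
      where
      above : ∀ r → (+_ ∘ b) CF< r → ∃ λ N → ∀ n → N ≤ n → s n ℚ.< r
      above r (ε , 0<ε , M , h) with upper (double (suc M))
      ... | N , lex = N + (n₀ + double (suc M)) , λ n le →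
        gap-above⇒< 0<ε (h (suc (double M)) (≤-trans (n≤double M) (n≤1+n _)))
        (ratio≤conv M n (≤-trans (m+n≤o⇒n≤o N le) (n≤1+n n)) (lex (suc n) (s≤s (m+n≤o⇒m≤o N le))))
      below : ∀ r → r <CF (+_ ∘ b) → ∀ N → ∃ λ n → N ≤ n × r ℚ.< s n
      below r (ε , 0<ε , M , h) N with recurs-at recurs (suc (double M)) N
      ... | n , N≤n , le , eq = n , N≤n , gap-below⇒< 0<ε (h (double M) (n≤double M))
        (conv≤ratio M n le (agree⇒lexLe (suc (double M)) b (window (suc n)) λ i i<l → sym (eq i i<l)))

-- Growth of the numerators and denominators.

module _ (a : ℕ → ℤ) (a-cf : IsCFSeq a) where

  private
    A : ℕ → ℕ
    A i = ℤ.∣ a i ∣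

  a≡+suc : ∀ i → ∃ λ c → a (suc i) ≡ +[1+ c ]
  a≡+suc i with a (suc i) | a-cf i
  ... | +[1+ c ] | _ = c , refl
  ... | + zero   | ℤ.+≤+ ()

  -- A nonnegative value followed by a positive one is enough of a start: since aₙ ≥ 1 for n ≥ 1,
  -- the solution then stays positive and never decreases.
  module _ (X : ℕ → ℤ) (X-rec : ∀ n → X (suc (suc n)) ≡ a n ℤ.* X (suc n) ℤ.+ X n)
           (m : ℕ) {u₀ v₀ : ℕ} (Xm : X (suc m) ≡ + u₀) (Xsm : X (suc (suc m)) ≡ +[1+ v₀ ]) where

    Growing : ℕ → Set
    Growing n = ∃ λ u → ∃ λ v → X n ≡ + u × X (suc n) ≡ +[1+ v ] ×
      X (suc (suc n)) ≡ + (A n * suc v + u) × suc v ≤ A n * suc v + u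

    X-next : ∀ n {u v} → X (suc n) ≡ + u → X (suc (suc n)) ≡ +[1+ v ] → Growing (suc n)
    X-next n {u} {v} eu ev with a≡+suc n
    ... | c , ec = u , v , eu , ev , trans (X-rec (suc n)) (trans (cong₂ ℤ._+_
        (trans (cong₂ ℤ._*_ ec ev) (trans (sym (ℤ.pos-* (suc c) (suc v)))
          (cong (λ t → + (ℤ.∣ t ∣ * suc v)) (sym ec)))) eu) refl)
      , ≤-trans (≤-trans (m≤m+n (suc v) (c * suc v)) (≤-reflexive (cong (λ t → ℤ.∣ t ∣ * suc v) (sym ec)))) (m≤m+n _ u)

    growing : ∀ i → Growing (suc (i + m))
    growing zero = X-next m Xm Xsm
    growing (suc i) with growing i
    -- The next value is at least v + 1, so it is a successor and `∸ 1` is exact.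
    ... | u , v , eu , ev , ew , le = X-next (suc (i + m)) {suc v} {A (suc (i + m)) * suc v + u ∸ 1} ev
      (trans ew (cong +_ (sym (m+[n∸m]≡n (≤-trans (s≤s z≤n) le)))))

    growing-from : ∀ n → suc m ≤ n → Growing n
    growing-from (suc n) (s≤s le) = subst (Growing ∘ suc) (m∸n+n≡m le) (growing (n ∸ m))

    ratios : ∀ s → (∀ n → suc (suc m) ≤ n → s n ≡ frac (X (suc (suc (suc n)))) (X (suc (suc n)))) → Ratios A s
    ratios s s≡ = record
      { n₀ = suc (suc m)
      ; y = λ n → ℤ.∣ X n ∣
      ; rec = λ n le → rec′ n (growing-from n (<⇒≤ le))
      ; pos = λ { (suc n) (s≤s le) → pos′ n (growing-from n le) }
      ; mono = λ { (suc n) (s≤s le) → mono′ n (growing-from n le) }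
      ; ratio = λ n le → trans (s≡ n le) (cong₂ frac
          (nonneg (suc (suc (suc n))) (growing-from (suc (suc (suc n))) (≤-trans (<⇒≤ le) (m≤n+m n 3))))
          (nonneg (suc (suc n)) (growing-from (suc (suc n)) (≤-trans (<⇒≤ le) (m≤n+m n 2)))))
      }
      where
      rec′ : ∀ n → Growing n → ℤ.∣ X (suc (suc n)) ∣ ≡ A n * ℤ.∣ X (suc n) ∣ + ℤ.∣ X n ∣
      rec′ n (u , v , eu , ev , ew , _) rewrite eu | ev | ew = refl
      pos′ : ∀ n → Growing n → 1 ≤ ℤ.∣ X (suc n) ∣
      pos′ n (u , v , eu , ev , _) rewrite ev = s≤s z≤n
      mono′ : ∀ n → Growing n → ℤ.∣ X (suc n) ∣ ≤ ℤ.∣ X (suc (suc n)) ∣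
      mono′ n (u , v , eu , ev , ew , le) rewrite ev | ew = le
      nonneg : ∀ n → Growing n → X n ≡ + ℤ.∣ X n ∣
      nonneg n (u , v , eu , _) rewrite eu = refl

  q-ratios : Ratios A (qRatio a)
  q-ratios = ratios (Q a) (λ _ → refl) 0 {0} {0} refl (cong (ℤ._+ + 1) (ℤ.*-zeroʳ (a 0))) (qRatio a) (λ _ _ → refl)

  -- The starting pair is p₋₁, p₀ for a₀ > 0; p₀, p₁ for a₀ = 0; and -p₁, -p₂ for a₀ < 0, where the
  -- sign cancels in the ratios.
  p-ratios : Ratios A (pRatio a)
  p-ratios with a 0 in eq
  ... | +[1+ c ] = ratios (P a) (λ _ → refl) 0 {1} {c} refl
        (trans (cong (λ t → t ℤ.* + 1 ℤ.+ + 0) eq) (trans (ℤ.+-identityʳ _) (ℤ.*-identityʳ _)))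
        (pRatio a) (λ _ _ → refl)
  ... | + zero = ratios (P a) (λ _ → refl) 1 {0} {0} P2
        (cong (ℤ._+ + 1) (trans (cong (a 1 ℤ.*_) P2) (ℤ.*-zeroʳ (a 1)))) (pRatio a) (λ _ _ → refl)
    where
    P2 : P a 2 ≡ + 0
    P2 = cong (λ t → t ℤ.* + 1 ℤ.+ + 0) eq
  -- For a₀ < 0 all numerators pₙ with n ≥ 2 are negative.
  ... | -[1+ c ] = ratios X X-rec 2 {proj₁ X3} {proj₁ X4} (proj₂ X3) (proj₂ X4) (pRatio a) same
    where
    X : ℕ → ℤ
    X n = ℤ.- P a n
    X-rec : ∀ n → X (suc (suc n)) ≡ a n ℤ.* X (suc n) ℤ.+ X n
    X-rec n = lemma (a n) (P a (suc n)) (P a n)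
      where
      lemma : ∀ c x y → ℤ.- (c ℤ.* x ℤ.+ y) ≡ c ℤ.* (ℤ.- x) ℤ.+ (ℤ.- y)
      lemma = ℤ-Solver.solve-∀
    X2 : X 2 ≡ +[1+ c ]
    X2 = trans (cong (λ t → ℤ.- (t ℤ.* + 1 ℤ.+ + 0)) eq)
               (cong ℤ.-_ (trans (ℤ.+-identityʳ _) (ℤ.*-identityʳ -[1+ c ])))
    -- -p₁ = a₁(-a₀) - 1 can be zero, namely for a₀ = -1 and a₁ = 1, so strict positivity starts
    -- only at -p₂.
    X3 : ∃ λ u → X 3 ≡ + u
    X3 with a≡+suc 0
    ... | d , ed = c + d * suc c , trans (X-rec 1) (trans (cong₂ (λ t x → t ℤ.* x ℤ.+ -[1+ 0 ]) ed X2) refl)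
    X4 : ∃ λ v → X 4 ≡ +[1+ v ]
    X4 with a≡+suc 1
    ... | d , ed = suc d * proj₁ X3 + c , trans (X-rec 2) (trans
      (cong₂ ℤ._+_ (trans (cong₂ ℤ._*_ ed (proj₂ X3)) (sym (ℤ.pos-* (suc d) _))) X2)
      (cong +_ (+-suc _ c)))
    frac-neg′ : ∀ x z {n} → ℤ.- z ≡ +[1+ n ] → frac x z ≡ frac (ℤ.- x) (ℤ.- z)
    frac-neg′ x -[1+ n ] refl = refl
    frac-neg′ x (+ zero) ()
    frac-neg′ x +[1+ n ] ()
    same : ∀ n → 4 ≤ n → pRatio a n ≡ frac (X (suc (suc (suc n)))) (X (suc (suc n)))
    same n le with growing-from X X-rec 2 {proj₁ X3} {proj₁ X4} (proj₂ X3) (proj₂ X4)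
                     (suc n) (≤-trans (<⇒≤ le) (n≤1+n n))
    ... | _ , v , _ , ev , _ = frac-neg′ (P a (3 + n)) (P a (2 + n)) ev

-- The lim inf and lim sup words of an automatic continued fraction.

module _ (k₀ : ℕ) (a : ℕ → ℤ) (a-cf : IsCFSeq a) (B : ℕ) (a≤B : ∀ i → ℤ.∣ a i ∣ ≤ B)
         (a-aut : Automatic (suc (suc k₀)) a) where

  private
    A : ℕ → ℕ
    A i = ℤ.∣ a i ∣

    A-aut : Büchi.AutomaticFun k₀ A
    A-aut = let (nQ , δ , q₀ , τ , eq) = a-aut
            in nQ , δ , q₀ , ℤ.∣_∣ ∘ τ , λ ds → cong ℤ.∣_∣ (eq ds)

    A≥1 : ∀ i → 1 ≤ i → 1 ≤ A i
    A≥1 (suc i) _ with a≡+suc a a-cf i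
    ... | c , eq rewrite eq = s≤s z≤n

    -- On values ≤ B the map B ∸_ reverses the order.
    module Least =
      Extremal k₀ A-aut a≤B id (B ∸_) id (λ {u} _ → m∸n≤m B u) (λ _ _ → id) ∸-cancelˡ-≡
    module Greatest =
      Extremal k₀ A-aut a≤B (B ∸_) id (λ {u} _ → m∸n≤m B u) id ∸-cancelˡ-≡ (λ _ _ → id)

    recurrent≥1 : ∀ (b : ℕ → ℕ) → (∀ l → InfinitelyOften λ n → l < n × ∀ i → i < l → A (n ∸ i) ≡ b i) → ∀ i → 1 ≤ b i
    recurrent≥1 b recurs i with recurs (suc i) 0
    -- Here n exceeds i + 1, so the letter is not read from a₀, which may be zero or negative.
    ... | n , _ , i<n , eq = subst (1 ≤_) (eq i ≤-refl) (A≥1 (n ∸ i) (m<n⇒0<n∸m (<-trans ≤-refl i<n)))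

    automaticCF : ∀ (b : ℕ → ℕ) → (∀ i → 1 ≤ b i) → (∀ i → b i ≤ B) → Büchi.AutomaticFun k₀ b →
                  AutomaticCF (suc (suc k₀)) (+_ ∘ b)
    automaticCF b b≥1 b≤B (nQ , δ , q₀ , τ , eq) =
      (λ i → ℤ.+≤+ (b≥1 (suc i))) , (B , b≤B) , nQ , δ , q₀ , +_ ∘ τ , λ ds → cong +_ (eq ds)

  automatic-liminf : ∀ {s} → Ratios A s → ∃ λ β → AutomaticCF (suc (suc k₀)) β × IsLiminf s β
  automatic-liminf R = +_ ∘ b , automaticCF b b≥1 Least.extremal≤ Least.extremal-automatic ,
    Comparison.liminf R b b≥1 Least.extremal-recurs λ l →
      let (N , min) = Least.extremal-minimal l
      in N , λ n N<n → ¬above⇒lexLe l b (λ i → A (n ∸ i)) λ (i , i<l , eqs , d) →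
        min n N<n (i , i<l , (λ j j<i → sym (eqs j j<i)) ,
          -- At odd places `Least` ranks by `B ∸_`, so a larger letter has the smaller rank.
          Sum.map₂ (λ (¬e , lt) → ¬e , ∸-monoʳ-< lt (a≤B _)) d)
    where
    b : ℕ → ℕ
    b = Least.extremal
    b≥1 = recurrent≥1 b Least.extremal-recurs

  automatic-limsup : ∀ {s} → Ratios A s → ∃ λ β → AutomaticCF (suc (suc k₀)) β × IsLimsup s β
  automatic-limsup R = +_ ∘ b , automaticCF b b≥1 Greatest.extremal≤ Greatest.extremal-automatic ,
    Comparison.limsup R b b≥1 Greatest.extremal-recurs λ l →
      let (N , max) = Greatest.extremal-minimal l
      in N , λ n N<n → ¬above⇒lexLe l (λ i → A (n ∸ i)) b λ (i , i<l , eqs , d) →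
        max n N<n (i , i<l , eqs , Sum.map₁ (λ (e , lt) → e , ∸-monoʳ-< lt (a≤B _)) d)
    where
    b : ℕ → ℕ
    b = Greatest.extremal
    b≥1 = recurrent≥1 b Greatest.extremal-recurs

theorem9 : (k : ℕ) → 2 ≤ k → (a : ℕ → ℤ) → AutomaticCF k a →
    (∃ λ β → AutomaticCF k β × IsLiminf (pRatio a) β) ×
    (∃ λ γ → AutomaticCF k γ × IsLiminf (qRatio a) γ) ×
    (∃ λ δ → AutomaticCF k δ × IsLimsup (pRatio a) δ) ×
    (∃ λ ζ → AutomaticCF k ζ × IsLimsup (qRatio a) ζ)
theorem9 (suc (suc k₀)) (s≤s (s≤s _)) a (a-cf , (B , a≤B) , a-aut) =
    automatic-liminf k₀ a a-cf B a≤B a-aut (p-ratios a a-cf)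
  , automatic-liminf k₀ a a-cf B a≤B a-aut (q-ratios a a-cf)
  , automatic-limsup k₀ a a-cf B a≤B a-aut (p-ratios a a-cf)
  , automatic-limsup k₀ a a-cf B a≤B a-aut (q-ratios a a-cf)
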